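{- Let $d\ge 4$ be an integer. The set of matrices in $ESL_2(\mathbb{Z}/\bar d\mathbb{Z})$ having determinant $+1$ and trace $d-1$ consists of: (1) the single conjugacy class $[F_z]$ if $d\not\equiv 3,6\pmod 9$; (2) the two disjoint conjugacy classes $[F_z]$, $[F_a]$ if $d\equiv 3\pmod 9$; (3) the two disjoint conjugacy classes $[F_z]$, $[F_a']$ if $d\equiv 6\pmod 9$, where $[F]$ denotes the conjugacy class of $F$ in the group $ESL_2(\mathbb{Z}/\bar d\mathbb{Z})$.
   Context: $\bar d=d$ if $d$ is odd and $\bar d=2d$ if $d$ is even. $ESL_2(\mathbb{Z}/\bar d\mathbb{Z})$ is the group of matrices in $GL_2(\mathbb{Z}/\bar d\mathbb{Z})$ with determinant $\pm1$. Define (entries read modulo $\bar d$) $F_z=\begin{pmatrix}0&d-1\\ d+1&d-1\end{pmatrix}$; if $d\equiv 3\pmod 9$, $F_a=\begin{pmatrix}1&d+3\\ \frac{4d-3}{3}&d-2\end{pmatrix}$; if $d\equiv 6\pmod 9$, $F_a'=\begin{pmatrix}1&d+3\\ \frac{2d-3}{3}&d-2\end{pmatrix}$. -}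

module Defs where

open import Data.Nat as ℕ using (ℕ; _%_; _/_; _∸_)
open import Data.Integer using (ℤ; +_; _+_; _-_; _*_; -_)
open import Data.Integer.Divisibility using (_∣_)
open import Data.Product using (_×_; Σ; ∃-syntax)
open import Data.Sum using (_⊎_)

dbar : ℕ → ℕ
dbar d with d % 2
... | 0 = 2 ℕ.* d
... | _ = d

infix 4 _≡[mod_]_
_≡[mod_]_ : ℤ → ℕ → ℤ → Set
a ≡[mod n ] b = (+ n) ∣ (a - b)

-- 2x2 matrices with integer entries, read modulo a modulus
record Mat : Set where
  constructor mat
  field
    a b c e : ℤ
open Mat public

det : Mat → ℤ
det M = a M * e M - b M * c M

tr : Mat → ℤ
tr M = a M + e M

infixl 7 _·_
_·_ : Mat → Mat → Mat
mat a₁ b₁ c₁ e₁ · mat a₂ b₂ c₂ e₂ =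
  mat (a₁ * a₂ + b₁ * c₂) (a₁ * b₂ + b₁ * e₂)
      (c₁ * a₂ + e₁ * c₂) (c₁ * b₂ + e₁ * e₂)

infix 4 _≈[_]_
_≈[_]_ : Mat → ℕ → Mat → Set
M ≈[ n ] N = (a M ≡[mod n ] a N) × (b M ≡[mod n ] b N)
           × (c M ≡[mod n ] c N) × (e M ≡[mod n ] e N)

InESL : ℕ → Mat → Set
InESL n M = (det M ≡[mod n ] + 1) ⊎ (det M ≡[mod n ] - + 1)

-- M and N are conjugate in ESL_2(Z/nZ): N = P M P⁻¹ for some P in ESL_2,
-- written as N P = P M (P is invertible since det P = ±1 is a unit)
Conj : ℕ → Mat → Mat → Set
Conj n M N = Σ Mat λ P → InESL n P × ((P · M) ≈[ n ] (N · P))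

Fz : ℕ → Mat
Fz d = mat (+ 0) (+ d - + 1) (+ d + + 1) (+ d - + 1)

-- used when d ≡ 3 (mod 9); then 3 ∣ d so (4d-3)/3 is exact
Fa : ℕ → Mat
Fa d = mat (+ 1) (+ d + + 3) (+ ((4 ℕ.* d ∸ 3) / 3)) (+ d - + 2)

-- used when d ≡ 6 (mod 9); then 3 ∣ d so (2d-3)/3 is exact
Fa' : ℕ → Mat
Fa' d = mat (+ 1) (+ d + + 3) (+ ((2 ℕ.* d ∸ 3) / 3)) (+ d - + 2)

DetTr : ℕ → Mat → Set
DetTr d M = InESL (dbar d) M × (det M ≡[mod dbar d ] + 1)
          × (tr M ≡[mod dbar d ] (+ d - + 1))

{-# OPTIONS --safe #-}
module Submission where

-- For v ∈ (ℤ/n)² put Q(v) = det (v, Mv), where n = dbar d.  In the basis v, (d + 1)Mv the matrix M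
-- becomes Fz, so M is conjugate to Fz as soon as Q(v) = ±(d + 1) is solvable modulo n.  As
-- Q((x + yM)v) = Q(v) · det (x + yM) and tr M = −1 modulo every prime p ∣ n, solutions modulo p lift
-- to prime powers and glue by the Chinese remainder theorem.  Modulo p ≠ 3 the form Q is
-- nondegenerate and takes both values ±1; modulo 3 it takes one of them unless M is scalar,
-- that is M = 1 modulo 3.  The latter is impossible if 9 ∣ d, and if 3 ∣ d, 9 ∤ d such M form a
-- second class: any two of them are conjugate modulo n/3 (both to Fz) and equal modulo 3.

open import Defs
open import Data.Nat using (ℕ; _≥_; _%_)
open import Data.Product using (_×_)
open import Data.Sum using (_⊎_)
open import Relation.Binary.PropositionalEquality using (_≡_; _≢_)
open import Relation.Nullary using (¬_)
open import Function.Bundles using (_⇔_)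

open import Data.Nat as ℕ using (zero; suc; _≤_; _<_; s≤s; NonZero)
import Data.Nat.Properties as ℕₚ
import Data.Nat.Divisibility as ℕ∣
import Data.Nat.DivMod as ℕDM
open import Data.Nat.Coprimality using (Coprime; coprime?; coprime-divisor; coprime-Bézout)
open import Data.Nat.GCD using (module Bézout)
open import Data.Nat.Primality using (Prime; prime?; prime[2]; euclidsLemma; prime⇒irreducible; ¬prime[1])
open import Data.Nat.Primality.Factorisation using (PrimeFactorisation; factorise)
open import Data.Integer as ℤ using (ℤ; +_; _+_; _-_; _*_; -_)
import Data.Integer.Properties as ℤₚ
open import Data.Integer.DivMod using (_%ℕ_; _/ℕ_; n%ℕd<d; a≡a%ℕn+[a/ℕn]*n)
open import Data.Integer.Divisibility.Signed
open import Data.Integer.Tactic.RingSolver using (solve-∀)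
import Data.Nat.Tactic.RingSolver as ℕ-Solver
open import Data.Fin as Fin using (Fin; toℕ; fromℕ<; splitAt; join)
import Data.Fin.Properties as Finₚ
open import Data.List using ([]; _∷_)
open import Data.Nat.ListAction using (product)
open import Data.List.Relation.Unary.All as All using (All; []; _∷_)
open import Data.Nat.ListAction.Properties using (∈⇒∣product)
open import Data.Product using (_,_; proj₁; proj₂; ∃₂; ∃-syntax; Σ)
open import Data.Sum using (inj₁; inj₂; [_,_]′)
open import Relation.Nullary using (yes; no; contradiction)
open import Relation.Nullary.Decidable using (toWitness; _×-dec_; Dec)
open import Relation.Binary.PropositionalEquality using (refl; sym; trans; cong; cong₂; subst)
open import Function using (_∘_; id)
open import Function.Bundles using (mk⇔)

-- Divisibility of integers

infixl 6 _⊕_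
infixr 7 _⊛_

_⊕_ : ∀ {n x y} → n ∣ x → n ∣ y → n ∣ x + y
_⊕_ = ∣m∣n⇒∣m+n

_⊛_ : ∀ {n x} k → n ∣ x → n ∣ k * x
k ⊛ h = ∣n⇒∣m*n k h

by-≡ : ∀ {n x y} → x ≡ y → n ∣ y → n ∣ x
by-≡ eq = subst (_ ∣_) (sym eq)

modulus-≡ : ∀ {m n z} → m ≡ n → m ∣ z → n ∣ z
modulus-≡ refl h = h

∣-diff-sym : ∀ {n} x y → n ∣ x - y → n ∣ y - x
∣-diff-sym x y h = by-≡ (eq x y) (- + 1 ⊛ h)
  where
  eq : ∀ x y → y - x ≡ - + 1 * (x - y)
  eq = solve-∀

∣-diff-trans : ∀ {n} x y z → n ∣ x - y → n ∣ y - z → n ∣ x - z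
∣-diff-trans x y z h k = by-≡ (eq x y z) (h ⊕ k)
  where
  eq : ∀ x y z → x - z ≡ (x - y) + (y - z)
  eq = solve-∀

≡⇒∣diff : ∀ {n x y} → x ≡ y → n ∣ x - y
≡⇒∣diff {n} {x} refl = divides (+ 0) (trans (ℤₚ.+-inverseʳ x) (sym (ℤₚ.*-zeroˡ n)))

+∣+ : ∀ {m n} → m ℕ∣.∣ n → + m ∣ + n
+∣+ = ∣ᵤ⇒∣

+∣+⁻¹ : ∀ {m n} → + m ∣ + n → m ℕ∣.∣ n
+∣+⁻¹ = ∣⇒∣ᵤ

prime-∣* : ∀ {p} x y → Prime p → + p ∣ x * y → + p ∣ x ⊎ + p ∣ y
prime-∣* {p} x y pr h with euclidsLemma ℤ.∣ x ∣ ℤ.∣ y ∣ pr (subst (p ℕ∣.∣_) (ℤₚ.abs-* x y) (∣⇒∣ᵤ h))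
... | inj₁ k = inj₁ (∣ᵤ⇒∣ k)
... | inj₂ k = inj₂ (∣ᵤ⇒∣ k)

prime∧∣prime⇒≡ : ∀ {p q} → Prime p → Prime q → p ℕ∣.∣ q → p ≡ q
prime∧∣prime⇒≡ pp pq h with prime⇒irreducible pq h
... | inj₁ refl = contradiction pp ¬prime[1]
... | inj₂ eq   = eq

prime∧∤⇒coprime : ∀ {p m} → Prime p → ¬ p ℕ∣.∣ m → Coprime p m
prime∧∤⇒coprime pr p∤m (d∣p , d∣m) with prime⇒irreducible pr d∣p
... | inj₁ eq   = eq
... | inj₂ refl = contradiction d∣m p∤m

bézout : ∀ {m n} → Coprime m n → ∃₂ λ i j → i * + m + j * + n ≡ + 1
bézout {m} {n} cop with coprime-Bézout cop
... | Bézout.+- x y eq = + x , - + y , trans (cong (_+ - + y * + n) (x*m x y m n eq)) (cancel (+ y) (+ n))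
  where
  cancel : ∀ y n → (+ 1 + y * n) + - y * n ≡ + 1
  cancel = solve-∀
  x*m : ∀ x y m n → 1 ℕ.+ y ℕ.* n ≡ x ℕ.* m → + x * + m ≡ + 1 + + y * + n
  x*m x y m n eq = trans (sym (ℤₚ.pos-* x m)) (trans (cong +_ (sym eq)) (cong (_+_ (+ 1)) (ℤₚ.pos-* y n)))
... | Bézout.-+ x y eq = - + x , + y , trans (cong (_+_ (- + x * + m)) (y*n x y m n eq)) (cancel (+ x) (+ m))
  where
  cancel : ∀ x m → - x * m + (+ 1 + x * m) ≡ + 1
  cancel = solve-∀
  y*n : ∀ x y m n → 1 ℕ.+ x ℕ.* m ≡ y ℕ.* n → + y * + n ≡ + 1 + + x * + m
  y*n x y m n eq = trans (sym (ℤₚ.pos-* y n)) (trans (cong +_ (sym eq)) (cong (_+_ (+ 1)) (ℤₚ.pos-* x m)))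

prime∧∤⇒inverse : ∀ {p} g → Prime p → ¬ + p ∣ g → ∃[ g′ ] + p ∣ g * g′ - + 1
prime∧∤⇒inverse {p} g pr p∤g
  with i , j , eq ← bézout (prime∧∤⇒coprime pr (p∤g ∘ ∣ᵤ⇒∣))
  with divides q ∣g∣≡qg ← m∣∣m∣ {g} =
  -- Bézout makes `j` an inverse of `∣g∣` modulo `p`, and `∣g∣ = q g`, so `j * q` inverts `g`.
  j * q , by-≡ (rearrange g i j q (+ p) (+ ℤ.∣ g ∣))
               (≡⇒∣diff eq ⊕ (- i ⊛ ∣-refl) ⊕ (- j ⊛ ≡⇒∣diff ∣g∣≡qg))
  where
  rearrange : ∀ g i j q p z →
    g * (j * q) - + 1 ≡ (i * p + j * z - + 1) + - i * p + - j * (z - q * g)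
  rearrange = solve-∀

-- In `z = z (i m) + z (j n)` the first summand is a multiple of `m n` because `n ∣ z`, the second
-- because `m ∣ z`.
coprime-∣*∣ : ∀ {m n} i j z → i * m + j * n ≡ + 1 → m ∣ z → n ∣ z → m * n ∣ z
coprime-∣*∣ {m} {n} i j z eq (divides q z≡qm) (divides r z≡rn) = divides (i * r + j * q)
  (trans (sym (ℤₚ.*-identityʳ z)) (trans (cong (z *_) (sym eq)) (trans (expand z i m j n)
    (trans (cong₂ (λ v w → v * (i * m) + w * (j * n)) z≡rn z≡qm) (collect i m j n q r)))))
  where
  expand : ∀ z i m j n → z * (i * m + j * n) ≡ z * (i * m) + z * (j * n)
  expand = solve-∀
  collect : ∀ i m j n q r → (r * n) * (i * m) + (q * m) * (j * n) ≡ (i * r + j * q) * (m * n)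
  collect = solve-∀

crt : ∀ {m n} i j → i * m + j * n ≡ + 1 → ∀ x y → ∃[ z ] m ∣ z - x × n ∣ z - y
crt {m} {n} i j eq x y = x * (j * n) + y * (i * m)
  , by-≡ (at-m x y i m j n) ((x ⊛ ≡⇒∣diff eq) ⊕ (((y - x) * i) ⊛ ∣-refl))
  , by-≡ (at-n x y i m j n) ((y ⊛ ≡⇒∣diff eq) ⊕ (((x - y) * j) ⊛ ∣-refl))
  where
  at-m : ∀ x y i m j n →
    x * (j * n) + y * (i * m) - x ≡ x * (i * m + j * n - + 1) + (y - x) * i * m
  at-m = solve-∀
  at-n : ∀ x y i m j n →
    x * (j * n) + y * (i * m) - y ≡ y * (i * m + j * n - + 1) + (x - y) * j * n
  at-n = solve-∀

-- Binary forms X² + kY² modulo an odd prime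

∣∧<⇒≡0 : ∀ {m n} → n ℕ∣.∣ m → m < n → m ≡ 0
∣∧<⇒≡0 {zero}  _   _   = refl
∣∧<⇒≡0 {suc m} n∣m m<n = contradiction n∣m (ℕ∣.>⇒∤ m<n)

residue : ∀ n .{{_ : NonZero n}} → ℤ → Fin n
residue n z = fromℕ< (n%ℕd<d z n)

residue-≡ : ∀ n .{{_ : NonZero n}} x y → residue n x ≡ residue n y → + n ∣ x - y
residue-≡ n x y eq = divides (x /ℕ n - y /ℕ n)
  (trans (cong₂ _-_ (a≡a%ℕn+[a/ℕn]*n x n) (a≡a%ℕn+[a/ℕn]*n y n))
    (trans (cong (λ r → (+ r + x /ℕ n * + n) - (+ (y %ℕ n) + y /ℕ n * + n)) %-eq)
      (collect (+ (y %ℕ n)) (x /ℕ n) (y /ℕ n) (+ n))))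
  where
  %-eq : x %ℕ n ≡ y %ℕ n
  %-eq = trans (sym (Finₚ.toℕ-fromℕ< (n%ℕd<d x n))) (trans (cong toℕ eq) (Finₚ.toℕ-fromℕ< (n%ℕd<d y n)))
  collect : ∀ r u v n → (r + u * n) - (r + v * n) ≡ (u - v) * n
  collect = solve-∀

square : ℕ → ℤ
square u = + u * + u

-- The prime divides `u − v` or `u + v`. Both have absolute value at most `2h`, hence the one it
-- divides is zero, and `u + v = 0` forces `u = v = 0`.
square-injective : ∀ {h u v} → Prime (suc (h ℕ.+ h)) → u ≤ h → v ≤ h →
  + suc (h ℕ.+ h) ∣ square u - square v → u ≡ v
square-injective {h} {u} {v} pr u≤h v≤h p∣ =
  [ (λ p∣- → ℤₚ.+-injective (ℤₚ.i-j≡0⇒i≡j (+ u) (+ v) (ℤₚ.∣i∣≡0⇒i≡0 (∣∧<⇒≡0 (∣⇒∣ᵤ p∣-) small))))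
  , (λ p∣+ → both-zero (∣∧<⇒≡0 (+∣+⁻¹ p∣+) (s≤s (ℕₚ.+-mono-≤ u≤h v≤h))))
  ]′ (prime-∣* (+ u - + v) (+ u + + v) pr (by-≡ (factor (+ u) (+ v)) p∣))
  where
  factor : ∀ x y → (x - y) * (x + y) ≡ x * x - y * y
  factor = solve-∀
  small : ℤ.∣ + u - + v ∣ < suc (h ℕ.+ h)
  small = s≤s (subst (λ z → ℤ.∣ z ∣ ≤ h ℕ.+ h) (sym (ℤₚ.m-n≡m⊖n u v))
    (ℕₚ.≤-trans (ℤₚ.∣m⊝n∣≤m⊔n u v) (ℕₚ.≤-trans (ℕₚ.⊔-lub u≤h v≤h) (ℕₚ.m≤m+n h h))))
  both-zero : u ℕ.+ v ≡ 0 → u ≡ v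
  both-zero eq = trans (ℕₚ.m+n≡0⇒m≡0 u eq) (sym (ℕₚ.m+n≡0⇒n≡0 u eq))

-- The h + 1 values X² and the h + 1 values w − kY² (0 ≤ X, Y ≤ h) cannot all differ mod 2h + 1.
X²+kY²-universal : ∀ h → Prime (suc (h ℕ.+ h)) → ∀ k w → ¬ + suc (h ℕ.+ h) ∣ k →
  ∃₂ λ X Y → + suc (h ℕ.+ h) ∣ X * X + k * (Y * Y) - w
X²+kY²-universal h pr k w p∤k = collision (Finₚ.pigeonhole p<2h+2 (residue p ∘ value ∘ splitAt (suc h)))
  where
  p = suc (h ℕ.+ h)
  Half = Fin (suc h)

  value : Half ⊎ Half → ℤ
  value = [ square ∘ toℕ , (λ j → w - k * square (toℕ j)) ]′

  p<2h+2 : p < suc h ℕ.+ suc h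
  p<2h+2 = s≤s (ℕₚ.≤-reflexive (sym (ℕₚ.+-suc h h)))

  toℕ≤h : (i : Half) → toℕ i ≤ h
  toℕ≤h = Finₚ.toℕ≤pred[n]

  solved : ∀ (i j : Half) → + p ∣ square (toℕ i) - (w - k * square (toℕ j)) →
    ∃₂ λ X Y → + p ∣ X * X + k * (Y * Y) - w
  solved i j h = + toℕ i , + toℕ j , by-≡ (eq (square (toℕ i)) (k * square (toℕ j)) w) h
    where
    eq : ∀ x y w → x + y - w ≡ x - (w - y)
    eq = solve-∀

  resolve : ∀ (s t : Half ⊎ Half) → s ≢ t → + p ∣ value s - value t →
    ∃₂ λ X Y → + p ∣ X * X + k * (Y * Y) - w
  resolve (inj₁ i) (inj₂ j) _ h = solved i j h
  resolve (inj₂ i) (inj₁ j) _ h = solved j i (∣-diff-sym (w - k * square (toℕ i)) _ h)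
  resolve (inj₁ i) (inj₁ j) s≢t h =
    contradiction (cong inj₁ (Finₚ.toℕ-injective (square-injective pr (toℕ≤h i) (toℕ≤h j) h))) s≢t
  resolve (inj₂ i) (inj₂ j) s≢t h =
    [ (λ p∣k → contradiction p∣k p∤k)
    , (λ p∣ → contradiction
        (cong inj₂ (sym (Finₚ.toℕ-injective (square-injective pr (toℕ≤h j) (toℕ≤h i) p∣)))) s≢t)
    ]′ (prime-∣* k (square (toℕ j) - square (toℕ i)) pr
         (by-≡ (eq k (square (toℕ i)) (square (toℕ j)) w) h))
    where
    eq : ∀ k x y w → k * (y - x) ≡ (w - k * x) - (w - k * y)
    eq = solve-∀

  collision : (∃₂ λ i j → i Fin.< j ×
      residue p (value (splitAt (suc h) i)) ≡ residue p (value (splitAt (suc h) j))) →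
    ∃₂ λ X Y → + p ∣ X * X + k * (Y * Y) - w
  collision (i , j , i<j , eq) = resolve (splitAt (suc h) i) (splitAt (suc h) j)
    (λ s≡t → Finₚ.<⇒≢ i<j (trans (sym (Finₚ.join-splitAt (suc h) (suc h) i))
      (trans (cong (join (suc h) (suc h)) s≡t) (Finₚ.join-splitAt (suc h) (suc h) j))))
    (residue-≡ p (value (splitAt (suc h) i)) (value (splitAt (suc h) j)) eq)

-- The quadratic form of a matrix

Q : Mat → ℤ → ℤ → ℤ
Q M x y = c M * (x * x) + (e M - a M) * (x * y) - b M * (y * y)

Q-cong : ∀ {n} M x y x′ y′ → n ∣ x′ - x → n ∣ y′ - y → n ∣ Q M x′ y′ - Q M x y
Q-cong (mat a b c e) x y x′ y′ hx hy = by-≡ (eq a b c e x y x′ y′)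
  (((c * (x′ + x) + (e - a) * y′) ⊛ hx) ⊕ (((e - a) * x - b * (y′ + y)) ⊛ hy))
  where
  eq : ∀ a b c e x y x′ y′ →
    (c * (x′ * x′) + (e - a) * (x′ * y′) - b * (y′ * y′)) - (c * (x * x) + (e - a) * (x * y) - b * (y * y))
    ≡ (c * (x′ + x) + (e - a) * y′) * (x′ - x) + ((e - a) * x - b * (y′ + y)) * (y′ - y)
  eq = solve-∀

-- Q M v = det (v, Mv), so replacing v by (x + yM)v multiplies it by det (x + yM).
Q-multiplicative : ∀ M x₀ y₀ x y →
  Q M (x * x₀ + y * (a M * x₀ + b M * y₀)) (x * y₀ + y * (c M * x₀ + e M * y₀))
  ≡ Q M x₀ y₀ * (x * x + tr M * (x * y) + det M * (y * y))
Q-multiplicative (mat a b c e) = eq a b c e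
  where
  eq : ∀ a b c e x₀ y₀ x y →
    let x′ = x * x₀ + y * (a * x₀ + b * y₀) ; y′ = x * y₀ + y * (c * x₀ + e * y₀) in
    c * (x′ * x′) + (e - a) * (x′ * y′) - b * (y′ * y′)
    ≡ (c * (x₀ * x₀) + (e - a) * (x₀ * y₀) - b * (y₀ * y₀))
      * (x * x + (a + e) * (x * y) + (a * e - b * c) * (y * y))
  eq = solve-∀

Represents : ℕ → Mat → ℤ → Set
Represents n M τ = ∃₂ λ x y → + n ∣ Q M x y - τ

-- Congruence to a scalar matrix; equivalently, all coefficients of the form `Q M` vanish modulo
-- `n`.
Scalar : ℕ → Mat → Set
Scalar n M = + n ∣ b M × + n ∣ c M × + n ∣ e M - a M

scalar? : ∀ n M → Dec (Scalar n M)
scalar? n M = (+ n ∣? b M) ×-dec (+ n ∣? c M) ×-dec (+ n ∣? (e M - a M))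

-- The coefficients are recovered from three values: `c = Q(1,0)`, `−b = Q(0,1)` and
-- `e − a = Q(1,1) − Q(1,0) − Q(0,1)`. If all three values vanish, so do the coefficients.
¬scalar⇒unit-value : ∀ n M → ¬ Scalar n M → ∃₂ λ x y → ¬ + n ∣ Q M x y
¬scalar⇒unit-value n M@(mat a b c e) ¬sc
  with + n ∣? Q M (+ 1) (+ 0) | + n ∣? Q M (+ 0) (+ 1) | + n ∣? Q M (+ 1) (+ 1)
... | no ∤₁  | _       | _      = + 1 , + 0 , ∤₁
... | yes _  | no ∤₂   | _      = + 0 , + 1 , ∤₂
... | yes _  | yes _   | no ∤₃  = + 1 , + 1 , ∤₃
... | yes h₁ | yes h₂  | yes h₃ = contradiction
  ( by-≡ (eq₁ a b c e) (- + 1 ⊛ h₂) , by-≡ (eq₂ a b c e) h₁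
  , by-≡ (eq₃ a b c e) (h₃ ⊕ (- + 1 ⊛ h₁) ⊕ (- + 1 ⊛ h₂)) ) ¬sc
  where
  eq₁ : ∀ a b c e → b ≡ - + 1 * (c * (+ 0 * + 0) + (e - a) * (+ 0 * + 1) - b * (+ 1 * + 1))
  eq₁ = solve-∀
  eq₂ : ∀ a b c e → c ≡ c * (+ 1 * + 1) + (e - a) * (+ 1 * + 0) - b * (+ 0 * + 0)
  eq₂ = solve-∀
  eq₃ : ∀ a b c e → e - a ≡ (c * (+ 1 * + 1) + (e - a) * (+ 1 * + 1) - b * (+ 1 * + 1))
    + - + 1 * (c * (+ 1 * + 1) + (e - a) * (+ 1 * + 0) - b * (+ 0 * + 0))
    + - + 1 * (c * (+ 0 * + 0) + (e - a) * (+ 0 * + 1) - b * (+ 1 * + 1))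
  eq₃ = solve-∀

-- Values of the form modulo primes

IsSign : ℤ → Set
IsSign s = s ≡ + 1 ⊎ s ≡ - + 1

sign² : ∀ {s} → IsSign s → s * s ≡ + 1
sign² (inj₁ refl) = refl
sign² (inj₂ refl) = refl

∣diff-remainder : ∀ z n .{{_ : NonZero n}} {r} → z %ℕ n ≡ r → + n ∣ z - + r
∣diff-remainder z n refl = divides (z /ℕ n)
  (trans (cong (_- + (z %ℕ n)) (a≡a%ℕn+[a/ℕn]*n z n)) (cancel (+ (z %ℕ n)) (z /ℕ n * + n)))
  where
  cancel : ∀ r q → (r + q) - r ≡ q
  cancel = solve-∀

∣diff-0 : ∀ {n} z → n ∣ z - + 0 → n ∣ z
∣diff-0 z = subst (_ ∣_) (ℤₚ.+-identityʳ z)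

-- Modulo 2 the two signs coincide, so an odd value serves for either of them. Modulo 3 they differ,
-- and the value itself dictates the sign.
2∤⇒∣diff-sign : ∀ {s} g → IsSign s → ¬ + 2 ∣ g → + 2 ∣ g - s
2∤⇒∣diff-sign g sgn 2∤g with g %ℕ 2 in eq | n%ℕd<d g 2
... | 0 | _ = contradiction (∣diff-0 g (∣diff-remainder g 2 eq)) 2∤g
... | suc (suc _) | s≤s (s≤s ())
... | 1 | _ with sgn
...   | inj₁ refl = ∣diff-remainder g 2 eq
...   | inj₂ refl = ∣-diff-trans g (+ 1) (- + 1) (∣diff-remainder g 2 eq) ∣-refl

3∤⇒∣diff-sign : ∀ g → ¬ + 3 ∣ g → ∃[ s ] IsSign s × + 3 ∣ g - s
3∤⇒∣diff-sign g 3∤g with g %ℕ 3 in eq | n%ℕd<d g 3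
... | 0 | _ = contradiction (∣diff-0 g (∣diff-remainder g 3 eq)) 3∤g
... | 1 | _ = + 1 , inj₁ refl , ∣diff-remainder g 3 eq
... | 2 | _ = - + 1 , inj₂ refl , ∣-diff-trans g (+ 2) (- + 1) (∣diff-remainder g 3 eq) ∣-refl
... | suc (suc (suc _)) | s≤s (s≤s (s≤s ()))

prime[3] : Prime 3
prime[3] = toWitness {a? = prime? 3} _

prime-2∨odd : ∀ {p} → Prime p → p ≡ 2 ⊎ ∃[ h ] p ≡ suc (h ℕ.+ h)
prime-2∨odd {p} pr with p ℕ.% 2 in eq | ℕDM.m%n<n p 2
... | 0 | _ = inj₁ (sym (prime∧∣prime⇒≡ prime[2] pr (ℕ∣.m%n≡0⇒n∣m p 2 eq)))
... | 1 | _ = inj₂ (p ℕ./ 2 , trans (ℕDM.m≡m%n+[m/n]*n p 2) (cong₂ ℕ._+_ eq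
  (trans (ℕₚ.*-comm (p ℕ./ 2) 2) (cong (p ℕ./ 2 ℕ.+_) (ℕₚ.+-identityʳ (p ℕ./ 2))))))
... | suc (suc _) | s≤s (s≤s ())

-- Modulo p the form is g · (x² − xy + y²) in a basis v, Mv with g = Q M v a unit,
-- and 4 (x² − xy + y²) = (2x − y)² + 3y².
norm-form-represents : ∀ {p} M H x₀ y₀ s g′ X y →
  p ∣ + 2 * H - + 1 → p ∣ det M - + 1 → p ∣ tr M + + 1 →
  p ∣ Q M x₀ y₀ * g′ - + 1 → p ∣ X * X + + 3 * (y * y) - + 4 * (s * g′) →
  ∃₂ λ x y → p ∣ Q M x y - s
norm-form-represents {p} M H x₀ y₀ s g′ X y p∣2H-1 p∣det p∣tr inv sol =
  x * x₀ + y * (a M * x₀ + b M * y₀) , x * y₀ + y * (c M * x₀ + e M * y₀) ,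
  by-≡ (cong (_- s) (Q-multiplicative M x₀ y₀ x y))
    (by-≡ (split g g′ s x y (tr M) (det M))
      ((g ⊛ norm) ⊕ (s ⊛ inv) ⊕ ((g * (x * y)) ⊛ p∣tr) ⊕ ((g * (y * y)) ⊛ p∣det)))
  where
  g = Q M x₀ y₀
  -- `H` is the inverse of 2 modulo `p`, so this `x` solves `2x − y = X`.
  x = H * (X + y)

  -- The factor 4 is cancelled by `H²`, since `4H² − 1 = (2H + 1)(2H − 1)`.
  ∣4*⇒∣ : ∀ z → p ∣ + 4 * z → p ∣ z
  ∣4*⇒∣ z h = by-≡ (eq z H) (((H * H) ⊛ h) ⊕ ((- z * (+ 2 * H + + 1)) ⊛ p∣2H-1))
    where
    eq : ∀ z H → z ≡ (H * H) * (+ 4 * z) + (- z * (+ 2 * H + + 1)) * (+ 2 * H - + 1)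
    eq = solve-∀

  norm : p ∣ (x * x - x * y + y * y) - s * g′
  norm = ∣4*⇒∣ ((x * x - x * y + y * y) - s * g′)
    (by-≡ (eq X y H (s * g′)) (sol ⊕ (((X + y) * (+ 2 * x - y + X)) ⊛ p∣2H-1)))
    where
    eq : ∀ X y H w →
      + 4 * ((H * (X + y) * (H * (X + y)) - H * (X + y) * y + y * y) - w)
      ≡ (X * X + + 3 * (y * y) - + 4 * w) + (X + y) * (+ 2 * (H * (X + y)) - y + X) * (+ 2 * H - + 1)
    eq = solve-∀

  split : ∀ g g′ s x y T δ → g * (x * x + T * (x * y) + δ * (y * y)) - s
    ≡ g * ((x * x - x * y + y * y) - s * g′) + s * (g * g′ - + 1)
      + (g * (x * y)) * (T + + 1) + (g * (y * y)) * (δ - + 1)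
  split = solve-∀

-- With `g′` inverse to the nonzero value at `(x₀, y₀)`, the equation `X² + 3y² = 4 s g′` is
-- solvable because `p ∤ 3`; completing the square backwards then gives the vector.
odd-represents : ∀ h → Prime (suc (h ℕ.+ h)) → suc (h ℕ.+ h) ≢ 3 → ∀ M →
  + suc (h ℕ.+ h) ∣ det M - + 1 → + suc (h ℕ.+ h) ∣ tr M + + 1 →
  ∀ x₀ y₀ → ¬ + suc (h ℕ.+ h) ∣ Q M x₀ y₀ → ∀ s → Represents (suc (h ℕ.+ h)) M s
odd-represents h pr p≢3 M p∣det p∣tr x₀ y₀ p∤g s = go (prime∧∤⇒inverse (Q M x₀ y₀) pr p∤g)
  where
  p = suc (h ℕ.+ h)

  p∤3 : ¬ + p ∣ + 3
  p∤3 p∣3 = p≢3 (prime∧∣prime⇒≡ pr prime[3] (+∣+⁻¹ p∣3))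

  -- The inverse of 2 modulo `2h + 1` is `h + 1`.
  p∣2H-1 : + p ∣ + 2 * + suc h - + 1
  p∣2H-1 = divides (+ 1) (eq (+ h))
    where
    eq : ∀ h → + 2 * (+ 1 + h) - + 1 ≡ + 1 * (+ 1 + (h + h))
    eq = solve-∀

  go : ∃[ g′ ] + p ∣ Q M x₀ y₀ * g′ - + 1 → Represents p M s
  go (g′ , inv) = finish (X²+kY²-universal h pr (+ 3) (+ 4 * (s * g′)) p∤3)
    where
    finish : (∃₂ λ X y → + p ∣ X * X + + 3 * (y * y) - + 4 * (s * g′)) → Represents p M s
    finish (X , y , sol) =
      norm-form-represents M (+ suc h) x₀ y₀ s g′ X y p∣2H-1 p∣det p∣tr inv sol

-- The discriminant `tr² − 4 det = (e − a)² + 4bc` vanishes for a scalar matrix, but it is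
-- `1 − 4 = −3` when the trace is -1 and the determinant 1.
scalar⇒∣3 : ∀ {n} M → + n ∣ det M - + 1 → + n ∣ tr M + + 1 → Scalar n M → + n ∣ + 3
scalar⇒∣3 (mat a b c e) n∣det n∣tr (n∣b , n∣c , n∣e-a) = by-≡ (eq a b c e)
  (((a + e - + 1) ⊛ n∣tr) ⊕ (- + 4 ⊛ n∣det) ⊕ (- (e - a) ⊛ n∣e-a) ⊕ ((- + 4 * b) ⊛ n∣c))
  where
  eq : ∀ a b c e → + 3 ≡ (a + e - + 1) * (a + e + + 1) + - + 4 * (a * e - b * c - + 1)
    + - (e - a) * (e - a) + (- + 4 * b) * c
  eq = solve-∀

prime≢3-represents : ∀ {p s} → Prime p → p ≢ 3 → ∀ M →
  + p ∣ det M - + 1 → + p ∣ tr M + + 1 → IsSign s → Represents p M s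
prime≢3-represents {p} {s} pr p≢3 M p∣det p∣tr sgn =
  from-unit (prime-2∨odd pr) (¬scalar⇒unit-value p M
    (λ sc → p≢3 (prime∧∣prime⇒≡ pr prime[3] (+∣+⁻¹ (scalar⇒∣3 M p∣det p∣tr sc)))))
  where
  from-unit : p ≡ 2 ⊎ (∃[ h ] p ≡ suc (h ℕ.+ h)) → (∃₂ λ x₀ y₀ → ¬ + p ∣ Q M x₀ y₀) → Represents p M s
  from-unit (inj₁ refl)       (x₀ , y₀ , p∤g) = x₀ , y₀ , 2∤⇒∣diff-sign (Q M x₀ y₀) sgn p∤g
  from-unit (inj₂ (h , refl)) (x₀ , y₀ , p∤g) = odd-represents h pr p≢3 M p∣det p∣tr x₀ y₀ p∤g s

-- From prime moduli to arbitrary moduli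

-- If q = τ (mod m) then k = msh, mh = q − τ, corrects q to τ (mod pm), since T = −1 and τ = s (mod p).
hensel : ∀ {p m} s τ T δ q h → s * s ≡ + 1 → p ∣ m → p ∣ T + + 1 → p ∣ τ - s → q - τ ≡ h * m →
  let k = m * (s * h) in m * p ∣ q * (+ 1 * + 1 + T * (+ 1 * k) + δ * (k * k)) - τ
hensel {p} {m} s τ T δ q h s²≡1 p∣m p∣T+1 p∣τ-s q-τ≡hm =
  by-≡ (trans (expand q τ T δ k) (trans (cong (λ z → z + (z + τ) * (T * k + δ * (k * k))) q-τ≡hm)
         (factor h m s τ T δ)))
    (*-monoʳ-∣ m ((h ⊛ p∣1+τsT) ⊕ ((h * (T * (s * h)) + (h * m + τ) * δ * (s * h) * (s * h)) ⊛ p∣m)))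
  where
  k = m * (s * h)
  expand : ∀ q τ T δ k → q * (+ 1 * + 1 + T * (+ 1 * k) + δ * (k * k)) - τ
    ≡ (q - τ) + ((q - τ) + τ) * (T * k + δ * (k * k))
  expand = solve-∀
  factor : ∀ h m s τ T δ →
    h * m + (h * m + τ) * (T * (m * (s * h)) + δ * (m * (s * h) * (m * (s * h))))
    ≡ m * (h * (+ 1 + τ * s * T)
           + (h * (T * (s * h)) + (h * m + τ) * δ * (s * h) * (s * h)) * m)
  factor = solve-∀
  p∣1+τsT : p ∣ + 1 + τ * s * T
  p∣1+τsT = by-≡ (eq τ s T) (((τ * s) ⊛ p∣T+1) ⊕ (- s ⊛ p∣τ-s) ⊕ (- + 1 ⊛ ≡⇒∣diff s²≡1))
    where
    eq : ∀ τ s T → + 1 + τ * s * T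
      ≡ (τ * s) * (T + + 1) + - s * (τ - s) + - + 1 * (s * s - + 1)
    eq = solve-∀

-- The target `τ` is replaced by the sign `s` modulo `p`. As `s` is its own inverse, it is what the
-- lifting step uses to divide by `τ`; the same `s` has to serve at every prime.
LocalSolution : Mat → ℤ → ℤ → ℕ → Set
LocalSolution M s τ p = + p ∣ tr M + + 1 × + p ∣ τ - s × Represents p M s

lift-same-prime : ∀ M s τ → s * s ≡ + 1 → ∀ {p m} → p ℕ∣.∣ m → LocalSolution M s τ p →
  Represents m M τ → Represents (p ℕ.* m) M τ
lift-same-prime M s τ s²≡1 {p} {m} p∣m (p∣tr , p∣τ , _) (x , y , divides h eq) =
  -- The corrected vector is `(1 + kM)v` with `v = (x, y)`.
  + 1 * x + k * (a M * x + b M * y) , + 1 * y + k * (c M * x + e M * y) ,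
  modulus-≡ (trans (sym (ℤₚ.pos-* m p)) (cong +_ (ℕₚ.*-comm m p)))
    (by-≡ (cong (_- τ) (Q-multiplicative M x y (+ 1) k))
      (hensel s τ (tr M) (det M) (Q M x y) h s²≡1 (+∣+ p∣m) p∣tr p∣τ eq))
  where
  k = + m * (s * h)

-- The vector at `p` represents only `s`, which agrees with `τ` there. Its coordinates are glued to
-- those of the vector modulo `m`.
lift-new-prime : ∀ M s τ {p m} → Coprime p m → LocalSolution M s τ p →
  Represents m M τ → Represents (p ℕ.* m) M τ
lift-new-prime M s τ {p} {m} cop (_ , p∣τ , x₀ , y₀ , p∣Q₀) (x , y , m∣Q) = go (bézout cop)
  where
  go : (∃₂ λ i j → i * + p + j * + m ≡ + 1) → Represents (p ℕ.* m) M τ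
  go (i , j , eq) = glue (crt i j eq x₀ x) (crt i j eq y₀ y)
    where
    glue : (∃[ z ] + p ∣ z - x₀ × + m ∣ z - x) → (∃[ z ] + p ∣ z - y₀ × + m ∣ z - y) →
      Represents (p ℕ.* m) M τ
    glue (X , px , mx) (Y , py , my) = X , Y , modulus-≡ (sym (ℤₚ.pos-* p m))
      (coprime-∣*∣ i j (Q M X Y - τ) eq
        (∣-diff-trans (Q M X Y) (Q M x₀ y₀) τ (Q-cong M x₀ y₀ X Y px py)
          (∣-diff-trans (Q M x₀ y₀) s τ p∣Q₀ (∣-diff-sym τ s p∣τ)))
        (∣-diff-trans (Q M X Y) (Q M x y) τ (Q-cong M x y X Y mx my) m∣Q))

-- Induction on the list of primes: a prime dividing the product of the later ones is handled by the
-- Hensel step, any other by the Chinese remainder theorem. The empty product is the modulus 1,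
-- where every vector works.
represents-product : ∀ M s τ → s * s ≡ + 1 → ∀ ps → All Prime ps → All (LocalSolution M s τ) ps →
  Represents (product ps) M τ
represents-product M s τ s²≡1 []       []         []         = + 0 , + 0 , 1∣ (Q M (+ 0) (+ 0) - τ)
  where
  1∣ : ∀ z → + 1 ∣ z
  1∣ z = divides z (sym (ℤₚ.*-identityʳ z))
represents-product M s τ s²≡1 (p ∷ ps) (pr ∷ prs) (loc ∷ locs) = step (p ℕ∣.∣? product ps)
  where
  rest = represents-product M s τ s²≡1 ps prs locs
  step : Dec (p ℕ∣.∣ product ps) → Represents (p ℕ.* product ps) M τ
  step (yes p∣m) = lift-same-prime M s τ s²≡1 p∣m loc rest
  step (no p∤m)  = lift-new-prime M s τ (prime∧∤⇒coprime pr p∤m) loc rest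

local⇒represents : ∀ n .{{_ : NonZero n}} M s τ → s * s ≡ + 1 →
  (∀ p → Prime p → p ℕ∣.∣ n → LocalSolution M s τ p) → Represents n M τ
local⇒represents n M s τ s²≡1 local =
  subst (λ k → Represents k M τ) (sym isFactorisation)
    (represents-product M s τ s²≡1 factors factorsPrime
      (All.tabulate λ {p} p∈ → local p (All.lookup factorsPrime p∈)
        (subst (p ℕ∣.∣_) (sym isFactorisation) (∈⇒∣product p∈))))
  where
  open PrimeFactorisation (factorise n)

-- Matrices modulo n

infix 4 _≅[_]_
-- This is `_≈[_]_` over signed divisibility, whose witnesses are integer quotients and so combine
-- linearly.
_≅[_]_ : Mat → ℕ → Mat → Set
M ≅[ n ] N = (+ n ∣ a M - a N) × (+ n ∣ b M - b N) × (+ n ∣ c M - c N) × (+ n ∣ e M - e N)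

mod⇒∣ : ∀ n x y → x ≡[mod n ] y → + n ∣ x - y
mod⇒∣ n x y h = ∣ᵤ⇒∣ h

∣⇒mod : ∀ n x y → + n ∣ x - y → x ≡[mod n ] y
∣⇒mod n x y h = ∣⇒∣ᵤ h

≈⇒≅ : ∀ n M N → M ≈[ n ] N → M ≅[ n ] N
≈⇒≅ n M N (h₁ , h₂ , h₃ , h₄) =
  mod⇒∣ n (a M) (a N) h₁ , mod⇒∣ n (b M) (b N) h₂ , mod⇒∣ n (c M) (c N) h₃ , mod⇒∣ n (e M) (e N) h₄

≅⇒≈ : ∀ n M N → M ≅[ n ] N → M ≈[ n ] N
≅⇒≈ n M N (h₁ , h₂ , h₃ , h₄) =
  ∣⇒mod n (a M) (a N) h₁ , ∣⇒mod n (b M) (b N) h₂ , ∣⇒mod n (c M) (c N) h₃ , ∣⇒mod n (e M) (e N) h₄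

≅-sym : ∀ n M N → M ≅[ n ] N → N ≅[ n ] M
≅-sym n M N (h₁ , h₂ , h₃ , h₄) =
  ∣-diff-sym (a M) (a N) h₁ , ∣-diff-sym (b M) (b N) h₂ ,
  ∣-diff-sym (c M) (c N) h₃ , ∣-diff-sym (e M) (e N) h₄

≅-trans : ∀ n L M N → L ≅[ n ] M → M ≅[ n ] N → L ≅[ n ] N
≅-trans n L M N (h₁ , h₂ , h₃ , h₄) (k₁ , k₂ , k₃ , k₄) =
  ∣-diff-trans (a L) (a M) (a N) h₁ k₁ , ∣-diff-trans (b L) (b M) (b N) h₂ k₂ ,
  ∣-diff-trans (c L) (c M) (c N) h₃ k₃ , ∣-diff-trans (e L) (e M) (e N) h₄ k₄

≅-reflexive : ∀ n {M N} → M ≡ N → M ≅[ n ] N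
≅-reflexive n {M} refl = ≡⇒∣diff {x = a M} refl , ≡⇒∣diff {x = b M} refl ,
  ≡⇒∣diff {x = c M} refl , ≡⇒∣diff {x = e M} refl

·-congˡ : ∀ n P M N → M ≅[ n ] N → (P · M) ≅[ n ] (P · N)
·-congˡ n (mat p q r s) (mat a b c e) (mat a′ b′ c′ e′) (h₁ , h₂ , h₃ , h₄) =
  lin p q a c a′ c′ h₁ h₃ , lin p q b e b′ e′ h₂ h₄ , lin r s a c a′ c′ h₁ h₃ , lin r s b e b′ e′ h₂ h₄
  where
  lin : ∀ u v x y x′ y′ → + n ∣ x - x′ → + n ∣ y - y′ → + n ∣ (u * x + v * y) - (u * x′ + v * y′)
  lin u v x y x′ y′ h k = by-≡ (eq u v x y x′ y′) ((u ⊛ h) ⊕ (v ⊛ k))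
    where
    eq : ∀ u v x y x′ y′ → (u * x + v * y) - (u * x′ + v * y′) ≡ u * (x - x′) + v * (y - y′)
    eq = solve-∀

·-congʳ : ∀ n P M N → M ≅[ n ] N → (M · P) ≅[ n ] (N · P)
·-congʳ n (mat p q r s) (mat a b c e) (mat a′ b′ c′ e′) (h₁ , h₂ , h₃ , h₄) =
  lin p r a b a′ b′ h₁ h₂ , lin q s a b a′ b′ h₁ h₂ , lin p r c e c′ e′ h₃ h₄ , lin q s c e c′ e′ h₃ h₄
  where
  lin : ∀ u v x y x′ y′ → + n ∣ x - x′ → + n ∣ y - y′ → + n ∣ (x * u + y * v) - (x′ * u + y′ * v)
  lin u v x y x′ y′ h k = by-≡ (eq u v x y x′ y′) ((u ⊛ h) ⊕ (v ⊛ k))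
    where
    eq : ∀ u v x y x′ y′ → (x * u + y * v) - (x′ * u + y′ * v) ≡ u * (x - x′) + v * (y - y′)
    eq = solve-∀

mat-≡ : ∀ {a b c e a′ b′ c′ e′} → a ≡ a′ → b ≡ b′ → c ≡ c′ → e ≡ e′ → mat a b c e ≡ mat a′ b′ c′ e′
mat-≡ refl refl refl refl = refl

·-assoc : ∀ L M N → (L · M) · N ≡ L · (M · N)
·-assoc (mat a b c e) (mat a′ b′ c′ e′) (mat a″ b″ c″ e″) =
  mat-≡ (eq a b a′ b′ c′ e′ a″ c″) (eq a b a′ b′ c′ e′ b″ e″)
        (eq c e a′ b′ c′ e′ a″ c″) (eq c e a′ b′ c′ e′ b″ e″)
  where
  eq : ∀ u v a b c e x y → (u * a + v * c) * x + (u * b + v * e) * y ≡ u * (a * x + b * y) + v * (c * x + e * y)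
  eq = solve-∀

det-· : ∀ M N → det (M · N) ≡ det M * det N
det-· (mat a b c e) (mat a′ b′ c′ e′) = eq a b c e a′ b′ c′ e′
  where
  eq : ∀ a b c e a′ b′ c′ e′ →
    (a * a′ + b * c′) * (c * b′ + e * e′) - (a * b′ + b * e′) * (c * a′ + e * c′)
    ≡ (a * e - b * c) * (a′ * e′ - b′ * c′)
  eq = solve-∀

det-cong : ∀ n M N → M ≅[ n ] N → + n ∣ det M - det N
det-cong n (mat a b c e) (mat a′ b′ c′ e′) (h₁ , h₂ , h₃ , h₄) =
  by-≡ (eq a b c e a′ b′ c′ e′) ((e ⊛ h₁) ⊕ (a′ ⊛ h₄) ⊕ (- c ⊛ h₂) ⊕ (- b′ ⊛ h₃))
  where
  eq : ∀ a b c e a′ b′ c′ e′ → (a * e - b * c) - (a′ * e′ - b′ * c′)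
    ≡ e * (a - a′) + a′ * (e - e′) + - c * (b - b′) + - b′ * (c - c′)
  eq = solve-∀

adj : Mat → Mat
adj (mat a b c e) = mat e (- b) (- c) a

det-adj : ∀ M → det (adj M) ≡ det M
det-adj (mat a b c e) = eq a b c e
  where
  eq : ∀ a b c e → e * a - - b * - c ≡ a * e - b * c
  eq = solve-∀

I₂ : Mat
I₂ = mat (+ 1) (+ 0) (+ 0) (+ 1)

·-identityʳ : ∀ M → M · I₂ ≡ M
·-identityʳ (mat a b c e) = mat-≡ (eq₁ a b) (eq₂ a b) (eq₁ c e) (eq₂ c e)
  where
  eq₁ : ∀ x y → x * + 1 + y * + 0 ≡ x
  eq₁ = solve-∀
  eq₂ : ∀ x y → x * + 0 + y * + 1 ≡ y
  eq₂ = solve-∀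

·-identityˡ : ∀ M → I₂ · M ≡ M
·-identityˡ (mat a b c e) = mat-≡ (eq₁ a c) (eq₁ b e) (eq₂ a c) (eq₂ b e)
  where
  eq₁ : ∀ x y → + 1 * x + + 0 * y ≡ x
  eq₁ = solve-∀
  eq₂ : ∀ x y → + 0 * x + + 1 * y ≡ y
  eq₂ = solve-∀

-- Frames: bases in which a matrix becomes Fz

-- These two divisibilities hold for `dbar d` and pass to its divisors, such as `n/3`. They give
-- `(d + 1)² = 1` modulo `n`.
ModulusFor : ℕ → ℕ → Set
ModulusFor d n = + n ∣ + 2 * + d × + n ∣ + d * + d

DetTr′ : ℕ → ℕ → Mat → Set
DetTr′ d n M = + n ∣ det M - + 1 × + n ∣ tr M - (+ d - + 1)

-- The columns are v and (d + 1)Mv; note (d + 1)² = 1 and d − 1 = −(d + 1) modulo n.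
basis : ℕ → Mat → ℤ → ℤ → Mat
basis d M x y = mat x ((+ d + + 1) * (a M * x + b M * y)) y ((+ d + + 1) * (c M * x + e M * y))

det-basis : ∀ d M x y → det (basis d M x y) ≡ (+ d + + 1) * Q M x y
det-basis d (mat a b c e) x y = eq (+ d) a b c e x y
  where
  eq : ∀ d a b c e x y →
    x * ((d + + 1) * (c * x + e * y)) - ((d + + 1) * (a * x + b * y)) * y
    ≡ (d + + 1) * (c * (x * x) + (e - a) * (x * y) - b * (y * y))
  eq = solve-∀

-- In the first column, `Mv = (d + 1)²Mv`. In the second, Cayley-Hamilton gives `M² = (d − 1)M − 1`,
-- and `−(d + 1) = d − 1` because `n ∣ 2d`.
basis-intertwines : ∀ d n M x y → ModulusFor d n → DetTr′ d n M →
  (M · basis d M x y) ≅[ n ] (basis d M x y · Fz d)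
basis-intertwines d n (mat a b c e) x y (n∣2d , n∣d²) (n∣det , n∣tr) =
  by-≡ (eq₁ (+ d) a b x y) ((- (a * x + b * y) ⊛ n∣d²) ⊕ (- (a * x + b * y) ⊛ n∣2d)) ,
  by-≡ (eq₂ (+ d) a b c e x y)
    (((u * (a * x + b * y)) ⊛ n∣tr) ⊕ (- (u * x) ⊛ n∣det) ⊕ (- x ⊛ n∣2d)) ,
  by-≡ (eq₁′ (+ d) c e x y) ((- (c * x + e * y) ⊛ n∣d²) ⊕ (- (c * x + e * y) ⊛ n∣2d)) ,
  by-≡ (eq₂′ (+ d) a b c e x y)
    (((u * (c * x + e * y)) ⊛ n∣tr) ⊕ (- (u * y) ⊛ n∣det) ⊕ (- y ⊛ n∣2d))
  where
  u = + d + + 1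
  eq₁ : ∀ d a b x y → (a * x + b * y) - (x * + 0 + (d + + 1) * (a * x + b * y) * (d + + 1))
    ≡ - (a * x + b * y) * (d * d) + - (a * x + b * y) * (+ 2 * d)
  eq₁ = solve-∀
  eq₁′ : ∀ d c e x y → (c * x + e * y) - (y * + 0 + (d + + 1) * (c * x + e * y) * (d + + 1))
    ≡ - (c * x + e * y) * (d * d) + - (c * x + e * y) * (+ 2 * d)
  eq₁′ = solve-∀
  eq₂ : ∀ d a b c e x y →
    (a * ((d + + 1) * (a * x + b * y)) + b * ((d + + 1) * (c * x + e * y)))
      - (x * (d - + 1) + (d + + 1) * (a * x + b * y) * (d - + 1))
    ≡ ((d + + 1) * (a * x + b * y)) * ((a + e) - (d - + 1))
      + - ((d + + 1) * x) * ((a * e - b * c) - + 1) + - x * (+ 2 * d)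
  eq₂ = solve-∀
  eq₂′ : ∀ d a b c e x y →
    (c * ((d + + 1) * (a * x + b * y)) + e * ((d + + 1) * (c * x + e * y)))
      - (y * (d - + 1) + (d + + 1) * (c * x + e * y) * (d - + 1))
    ≡ ((d + + 1) * (c * x + e * y)) * ((a + e) - (d - + 1))
      + - ((d + + 1) * y) * ((a * e - b * c) - + 1) + - y * (+ 2 * d)
  eq₂′ = solve-∀

-- Multiplying the relation of `basis-intertwines` by the adjugate on both sides yields this one
-- only up to the factor `det (basis d M x y)`; comparing entries gives it directly.
adj-basis-intertwines : ∀ d n M x y → ModulusFor d n → DetTr′ d n M →
  (adj (basis d M x y) · M) ≅[ n ] (Fz d · adj (basis d M x y))
adj-basis-intertwines d n (mat a b c e) x y (n∣2d , n∣d²) (n∣det , n∣tr) =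
  by-≡ (eq₁ (+ d) a b c e x y) (((u * y) ⊛ n∣det) ⊕ (y ⊛ n∣2d)) ,
  by-≡ (eq₂ (+ d) a b c e x y) ((- (u * x) ⊛ n∣det) ⊕ (- x ⊛ n∣2d)) ,
  by-≡ (eq₃ (+ d) a c e x y) ((- (c * x + e * y) ⊛ n∣d²) ⊕ (- (c * x + e * y) ⊛ n∣2d) ⊕ (- y ⊛ n∣tr)) ,
  by-≡ (eq₄ (+ d) a b e x y) (((a * x + b * y) ⊛ n∣d²) ⊕ ((a * x + b * y) ⊛ n∣2d) ⊕ (x ⊛ n∣tr))
  where
  u = + d + + 1
  eq₁ : ∀ d a b c e x y →
    ((d + + 1) * (c * x + e * y) * a + - ((d + + 1) * (a * x + b * y)) * c)
      - (+ 0 * ((d + + 1) * (c * x + e * y)) + (d - + 1) * - y)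
    ≡ ((d + + 1) * y) * ((a * e - b * c) - + 1) + y * (+ 2 * d)
  eq₁ = solve-∀
  eq₂ : ∀ d a b c e x y →
    ((d + + 1) * (c * x + e * y) * b + - ((d + + 1) * (a * x + b * y)) * e)
      - (+ 0 * - ((d + + 1) * (a * x + b * y)) + (d - + 1) * x)
    ≡ - ((d + + 1) * x) * ((a * e - b * c) - + 1) + - x * (+ 2 * d)
  eq₂ = solve-∀
  eq₃ : ∀ d a c e x y →
    (- y * a + x * c) - ((d + + 1) * ((d + + 1) * (c * x + e * y)) + (d - + 1) * - y)
    ≡ - (c * x + e * y) * (d * d) + - (c * x + e * y) * (+ 2 * d) + - y * ((a + e) - (d - + 1))
  eq₃ = solve-∀
  eq₄ : ∀ d a b e x y →
    (- y * b + x * e) - ((d + + 1) * - ((d + + 1) * (a * x + b * y)) + (d - + 1) * x)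
    ≡ (a * x + b * y) * (d * d) + (a * x + b * y) * (+ 2 * d) + x * ((a + e) - (d - + 1))
  eq₄ = solve-∀

-- Up to the sign `s`, `adj R` is the inverse of `R`. Thus `adj-comm` carries `M` to `Fz d`, and
-- `R-comm` carries `Fz d` back to `M`.
record Frame (d n : ℕ) (M : Mat) (s : ℤ) : Set where
  field
    R      : Mat
    det≡s  : + n ∣ det R - s
    R-comm : (M · R) ≅[ n ] (R · Fz d)
    adj-comm : (adj R · M) ≅[ n ] (Fz d · adj R)

-- The basis has determinant `(d + 1) Q(v)`, so the value `s (d + 1)` makes it `s (d + 1)² = s`.
represents⇒frame : ∀ {d n} M s → ModulusFor d n → DetTr′ d n M →
  Represents n M (s * (+ d + + 1)) → Frame d n M s
represents⇒frame {d} {n} M s md@(n∣2d , n∣d²) dt (x , y , n∣Q) = record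
  { R        = basis d M x y
  ; det≡s    = by-≡ (cong (_- s) (det-basis d M x y))
                 (by-≡ (eq (+ d) s (Q M x y)) (((+ d + + 1) ⊛ n∣Q) ⊕ (s ⊛ n∣d²) ⊕ (s ⊛ n∣2d)))
  ; R-comm   = basis-intertwines d n M x y md dt
  ; adj-comm = adj-basis-intertwines d n M x y md dt
  }
  where
  eq : ∀ d s q → (d + + 1) * q - s ≡ (d + + 1) * (q - s * (d + + 1)) + s * (d * d) + s * (+ 2 * d)
  eq = solve-∀

-- Every prime `p ∣ n` divides `d` because `n ∣ d²`; hence modulo `p` the trace is -1 and the target
-- `s (d + 1)` is `s`. Only the prime 3 needs its solution from outside.
frame-exists : ∀ d n .{{_ : NonZero n}} M s → ModulusFor d n → DetTr′ d n M → IsSign s →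
  (3 ℕ∣.∣ n → Represents 3 M s) → Frame d n M s
frame-exists d n M s md@(_ , n∣d²) dt@(n∣det , n∣tr) sgn at-3 =
  represents⇒frame M s md dt (local⇒represents n M s (s * (+ d + + 1)) (sign² sgn) local)
  where
  local : ∀ p → Prime p → p ℕ∣.∣ n → LocalSolution M s (s * (+ d + + 1)) p
  local p pr p∣n = p∣tr+1 , by-≡ (eq₂ s (+ d)) (s ⊛ p∣d) , solution (p ℕ.≟ 3)
    where
    p∣d : + p ∣ + d
    p∣d = [ id , id ]′ (prime-∣* (+ d) (+ d) pr (∣-trans (+∣+ p∣n) n∣d²))
    eq₁ : ∀ T d → T + + 1 ≡ (T - (d - + 1)) + d
    eq₁ = solve-∀
    eq₂ : ∀ s d → s * (d + + 1) - s ≡ s * d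
    eq₂ = solve-∀
    p∣tr+1 : + p ∣ tr M + + 1
    p∣tr+1 = by-≡ (eq₁ (tr M) (+ d)) (∣-trans (+∣+ p∣n) n∣tr ⊕ p∣d)
    solution : Dec (p ≡ 3) → Represents p M s
    solution (yes refl) = at-3 p∣n
    solution (no p≢3)   = prime≢3-represents pr p≢3 M (∣-trans (+∣+ p∣n) n∣det) p∣tr+1 sgn

sign-det⇒InESL : ∀ n P s → IsSign s → + n ∣ det P - s → InESL n P
sign-det⇒InESL n P s (inj₁ refl) h = inj₁ (∣⇒mod n (det P) (+ 1) h)
sign-det⇒InESL n P s (inj₂ refl) h = inj₂ (∣⇒mod n (det P) (- + 1) h)

frame⇒Conj : ∀ {d n} M s → IsSign s → Frame d n M s → Conj n M (Fz d)
frame⇒Conj {d} {n} M s sgn f = adj R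
  , sign-det⇒InESL n (adj R) s sgn (by-≡ (cong (_- s) (det-adj R)) det≡s)
  , ≅⇒≈ n (adj R · M) (Fz d · adj R) adj-comm
  where open Frame f

-- A nonzero value of the form modulo 3 fixes the sign `s`, and all other primes accept either sign,
-- so one `s` works for the whole modulus. This is where determinant -1 may be forced on the
-- conjugating matrix; if `3 ∤ n`, the sign +1 is available.
¬scalar₃⇒Conj-Fz : ∀ d n .{{_ : NonZero n}} M → ModulusFor d n → DetTr′ d n M →
  (3 ℕ∣.∣ n → ¬ Scalar 3 M) → Conj n M (Fz d)
¬scalar₃⇒Conj-Fz d n M md dt ¬sc = from (3 ℕ∣.∣? n)
  where
  from : Dec (3 ℕ∣.∣ n) → Conj n M (Fz d)
  from (no 3∤n)  = frame⇒Conj M (+ 1) (inj₁ refl)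
    (frame-exists d n M (+ 1) md dt (inj₁ refl) (λ 3∣n → contradiction 3∣n 3∤n))
  from (yes 3∣n) = unit (¬scalar⇒unit-value 3 M (¬sc 3∣n))
    where
    unit : (∃₂ λ x y → ¬ + 3 ∣ Q M x y) → Conj n M (Fz d)
    unit (x , y , 3∤) = sign (3∤⇒∣diff-sign (Q M x y) 3∤)
      where
      sign : (∃[ s ] IsSign s × + 3 ∣ Q M x y - s) → Conj n M (Fz d)
      sign (s , sgn , h) = frame⇒Conj M s sgn (frame-exists d n M s md dt sgn (λ _ → x , y , h))

-- Conjugation invariants and gluing at 3

InESL⇒sign : ∀ n P → InESL n P → ∃[ s ] IsSign s × + n ∣ det P - s
InESL⇒sign n P (inj₁ h) = + 1 , inj₁ refl , mod⇒∣ n (det P) (+ 1) h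
InESL⇒sign n P (inj₂ h) = - + 1 , inj₂ refl , mod⇒∣ n (det P) (- + 1) h

sign-unit-cancel : ∀ {n} s δ z → IsSign s → n ∣ δ - s → n ∣ δ * z → n ∣ z
sign-unit-cancel s δ z sgn hδ h =
  by-≡ (eq s δ z) ((s ⊛ h) ⊕ (- (s * z) ⊛ hδ) ⊕ (- z ⊛ ≡⇒∣diff (sign² sgn)))
  where
  eq : ∀ s δ z → z ≡ s * (δ * z) + - (s * z) * (δ - s) + - z * (s * s - + 1)
  eq = solve-∀

intertwines⇒det : ∀ n P M N → (P · M) ≅[ n ] (N · P) → + n ∣ det P * (det M - det N)
intertwines⇒det n P M N h =
  by-≡ (trans (eq (det P) (det M) (det N)) (sym (cong₂ _-_ (det-· P M) (det-· N P))))
    (det-cong n (P · M) (N · P) h)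
  where
  eq : ∀ p m n → p * (m - n) ≡ p * m - n * p
  eq = solve-∀

-- Take the trace of `adj P · (PM − NP)`: by cyclicity it equals `det P (tr M − tr N)`.
intertwines⇒tr : ∀ n P M N → (P · M) ≅[ n ] (N · P) → + n ∣ det P * (tr M - tr N)
intertwines⇒tr n (mat p q r s) (mat a b c e) (mat a′ b′ c′ e′) (h₁ , h₂ , h₃ , h₄) =
  by-≡ (eq p q r s a b c e a′ b′ c′ e′) ((s ⊛ h₁) ⊕ (- q ⊛ h₃) ⊕ (- r ⊛ h₂) ⊕ (p ⊛ h₄))
  where
  eq : ∀ p q r s a b c e a′ b′ c′ e′ → (p * s - q * r) * ((a + e) - (a′ + e′))
    ≡ s * ((p * a + q * c) - (a′ * p + b′ * r)) + - q * ((r * a + s * c) - (c′ * p + e′ * r))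
      + - r * ((p * b + q * e) - (a′ * q + b′ * s)) + p * ((r * b + s * e) - (c′ * q + e′ * s))
  eq = solve-∀

Conj⇒DetTr′ : ∀ d n M N → DetTr′ d n N → Conj n M N → DetTr′ d n M
Conj⇒DetTr′ d n M N (N-det , N-tr) (P , P∈ESL , P-comm) = from-sign (InESL⇒sign n P P∈ESL)
  where
  PM≅NP = ≈⇒≅ n (P · M) (N · P) P-comm
  from-sign : (∃[ s ] IsSign s × + n ∣ det P - s) → DetTr′ d n M
  from-sign (s , sgn , h) =
    ∣-diff-trans (det M) (det N) (+ 1)
      (sign-unit-cancel s (det P) (det M - det N) sgn h (intertwines⇒det n P M N PM≅NP)) N-det ,
    ∣-diff-trans (tr M) (tr N) (+ d - + 1)
      (sign-unit-cancel s (det P) (tr M - tr N) sgn h (intertwines⇒tr n P M N PM≅NP)) N-tr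

DetTr′-Fz : ∀ d n → ModulusFor d n → DetTr′ d n (Fz d)
DetTr′-Fz d n (_ , n∣d²) = by-≡ (eq (+ d)) (- + 1 ⊛ n∣d²) , ≡⇒∣diff (ℤₚ.+-identityˡ (+ d - + 1))
  where
  eq : ∀ d → + 0 * (d - + 1) - (d - + 1) * (d + + 1) - + 1 ≡ - + 1 * (d * d)
  eq = solve-∀

-- If the diagonal entries agree modulo 3, then `2a = tr M = d − 1 = −1`, so `a = 1`.
scalar₃⇒≅I : ∀ d n M → 3 ℕ∣.∣ n → 3 ℕ∣.∣ d → DetTr′ d n M → Scalar 3 M → M ≅[ 3 ] I₂
scalar₃⇒≅I d n (mat a b c e) 3∣n 3∣d (_ , n∣tr) (3∣b , 3∣c , 3∣e-a) =
  3∣a-1 , by-≡ (ℤₚ.+-identityʳ b) 3∣b , by-≡ (ℤₚ.+-identityʳ c) 3∣c ,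
  by-≡ (eq′ a e) (3∣a-1 ⊕ 3∣e-a)
  where
  eq : ∀ a e d → a - + 1 ≡ - + 1 * ((a + e) - (d - + 1)) + - + 1 * d + (e - a) + a * + 3
  eq = solve-∀
  eq′ : ∀ a e → e - + 1 ≡ (a - + 1) + (e - a)
  eq′ = solve-∀
  3∣a-1 : + 3 ∣ a - + 1
  3∣a-1 = by-≡ (eq a e (+ d))
    ((- + 1 ⊛ ∣-trans (+∣+ 3∣n) n∣tr) ⊕ (- + 1 ⊛ +∣+ 3∣d) ⊕ 3∣e-a ⊕ (a ⊛ ∣-refl))

restrict-modulus : ∀ {d m n} → m ℕ∣.∣ n → ModulusFor d n → ModulusFor d m
restrict-modulus m∣n (h , k) = ∣-trans (+∣+ m∣n) h , ∣-trans (+∣+ m∣n) k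

restrict-DetTr′ : ∀ {d m n M} → m ℕ∣.∣ n → DetTr′ d n M → DetTr′ d m M
restrict-DetTr′ m∣n (h , k) = ∣-trans (+∣+ m∣n) h , ∣-trans (+∣+ m∣n) k

-- The composite `R′ · adj R` carries `M` to `Fz d` and then to `F`. Both frames have sign +1, so
-- its determinant is 1.
frames⇒intertwiner : ∀ d n M F → Frame d n M (+ 1) → Frame d n F (+ 1) →
  Σ Mat λ P → + n ∣ det P - + 1 × (P · M) ≅[ n ] (F · P)
frames⇒intertwiner d n M F f g =
  P , by-≡ (cong (_- + 1) (trans (det-· R′ (adj R)) (cong (det R′ *_) (det-adj R))))
        (by-≡ (eq (det R′) (det R)) ((det R ⊛ G.det≡s) ⊕ F.det≡s)) ,
  ≅-trans n (P · M) (R′ · (adj R · M)) (F · P) (≅-reflexive n (·-assoc R′ (adj R) M))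
    (≅-trans n (R′ · (adj R · M)) (R′ · (Fz d · adj R)) (F · P)
      (·-congˡ n R′ (adj R · M) (Fz d · adj R) F.adj-comm)
      (≅-trans n (R′ · (Fz d · adj R)) ((R′ · Fz d) · adj R) (F · P)
        (≅-reflexive n (sym (·-assoc R′ (Fz d) (adj R))))
        (≅-trans n ((R′ · Fz d) · adj R) ((F · R′) · adj R) (F · P)
          (·-congʳ n (adj R) (R′ · Fz d) (F · R′) (≅-sym n (F · R′) (R′ · Fz d) G.R-comm))
          (≅-reflexive n (·-assoc F R′ (adj R))))))
  where
  module F = Frame f
  module G = Frame g
  R = F.R
  R′ = G.R
  P = R′ · adj R
  eq : ∀ x y → x * y - + 1 ≡ y * (x - + 1) + (y - + 1)
  eq = solve-∀

crt-mat : ∀ {m n} → Coprime m n → ∀ M N → Σ Mat λ P → P ≅[ m ] M × P ≅[ n ] N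
crt-mat {m} {n} cop M N = go (bézout cop)
  where
  go : (∃₂ λ i j → i * + m + j * + n ≡ + 1) → Σ Mat λ P → P ≅[ m ] M × P ≅[ n ] N
  go (i , j , eq) = glue (entry (a M) (a N)) (entry (b M) (b N)) (entry (c M) (c N)) (entry (e M) (e N))
    where
    entry : ∀ x y → ∃[ z ] + m ∣ z - x × + n ∣ z - y
    entry = crt i j eq
    glue : (∃[ z ] + m ∣ z - a M × + n ∣ z - a N) → (∃[ z ] + m ∣ z - b M × + n ∣ z - b N) →
      (∃[ z ] + m ∣ z - c M × + n ∣ z - c N) → (∃[ z ] + m ∣ z - e M × + n ∣ z - e N) →
      Σ Mat λ P → P ≅[ m ] M × P ≅[ n ] N
    glue (p , p₁ , p₂) (q , q₁ , q₂) (r , r₁ , r₂) (s , s₁ , s₂) =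
      mat p q r s , (p₁ , q₁ , r₁ , s₁) , (p₂ , q₂ , r₂ , s₂)

∣-coprime-* : ∀ {m n} → Coprime m n → ∀ z → + m ∣ z → + n ∣ z → + (m ℕ.* n) ∣ z
∣-coprime-* {m} {n} cop z h k = go (bézout cop)
  where
  go : (∃₂ λ i j → i * + m + j * + n ≡ + 1) → + (m ℕ.* n) ∣ z
  go (i , j , eq) = modulus-≡ (sym (ℤₚ.pos-* m n)) (coprime-∣*∣ i j z eq h k)

scalar₃⇒Conj : ∀ d m .{{_ : NonZero m}} M F → ¬ 3 ℕ∣.∣ m → 3 ℕ∣.∣ d → ModulusFor d (3 ℕ.* m) →
  DetTr′ d (3 ℕ.* m) M → DetTr′ d (3 ℕ.* m) F → Scalar 3 M → Scalar 3 F → Conj (3 ℕ.* m) M F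
scalar₃⇒Conj d m M F 3∤m 3∣d md dtM dtF scM scF =
  from-intertwiner (frames⇒intertwiner d m M F (frame M dtM) (frame F dtF))
  where
  n = 3 ℕ.* m
  m∣n : m ℕ∣.∣ n
  m∣n = ℕ∣.n∣m*n 3
  3∣n : 3 ℕ∣.∣ n
  3∣n = ℕ∣.m∣m*n m
  cop : Coprime 3 m
  cop = prime∧∤⇒coprime prime[3] 3∤m
  M≅I = scalar₃⇒≅I d n M 3∣n 3∣d dtM scM
  F≅I = scalar₃⇒≅I d n F 3∣n 3∣d dtF scF

  -- Since `3 ∤ m`, the sign may be prescribed; choosing +1 for both matrices gives a conjugating
  -- matrix of determinant 1 modulo `m`.
  frame : ∀ N → DetTr′ d n N → Frame d m N (+ 1)
  frame N dt = frame-exists d m N (+ 1) (restrict-modulus {d} m∣n md) (restrict-DetTr′ {d} {M = N} m∣n dt)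
    (inj₁ refl) (λ 3∣m → contradiction 3∣m 3∤m)

  from-intertwiner : (Σ Mat λ P → + m ∣ det P - + 1 × (P · M) ≅[ m ] (F · P)) → Conj n M F
  -- Modulo 3 both matrices are the identity, so every matrix intertwines them; `I₂` is taken
  -- because its determinant matches that of `P`.
  from-intertwiner (P , P-det , P-comm) = lift (crt-mat cop I₂ P)
    where
    lift : (Σ Mat λ S → S ≅[ 3 ] I₂ × S ≅[ m ] P) → Conj n M F
    lift (S , S≅I , S≅P) = S
      , sign-det⇒InESL n S (+ 1) (inj₁ refl) (∣-coprime-* cop (det S - + 1)
          (det-cong 3 S I₂ S≅I) (∣-diff-trans (det S) (det P) (+ 1) (det-cong m S P S≅P) P-det))
      , ≅⇒≈ n (S · M) (F · S) (combine (S · M) (F · S) at-3 at-m)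
      where
      at-3 : (S · M) ≅[ 3 ] (F · S)
      at-3 = ≅-trans 3 (S · M) S (F · S)
        (≅-trans 3 (S · M) (S · I₂) S (·-congˡ 3 S M I₂ M≅I) (≅-reflexive 3 (·-identityʳ S)))
        (≅-trans 3 S (I₂ · S) (F · S) (≅-reflexive 3 (sym (·-identityˡ S)))
          (·-congʳ 3 S I₂ F (≅-sym 3 F I₂ F≅I)))
      at-m : (S · M) ≅[ m ] (F · S)
      at-m = ≅-trans m (S · M) (P · M) (F · S) (·-congʳ m M S P S≅P)
        (≅-trans m (P · M) (F · P) (F · S) P-comm (·-congˡ m F P S (≅-sym m S P S≅P)))
      combine : ∀ A B → A ≅[ 3 ] B → A ≅[ m ] B → A ≅[ n ] B
      combine A B (h₁ , h₂ , h₃ , h₄) (k₁ , k₂ , k₃ , k₄) =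
        ∣-coprime-* cop (a A - a B) h₁ k₁ , ∣-coprime-* cop (b A - b B) h₂ k₂ ,
        ∣-coprime-* cop (c A - c B) h₃ k₃ , ∣-coprime-* cop (e A - e B) h₄ k₄

-- The modulus dbar d and the residue of d modulo 9

dbar-spec : ∀ d → dbar d ≡ d ⊎ (dbar d ≡ 2 ℕ.* d × 2 ℕ∣.∣ d)
dbar-spec d with d % 2 in eq
... | 0     = inj₂ (refl , ℕ∣.m%n≡0⇒n∣m d 2 eq)
... | suc _ = inj₁ refl

dbar-modulus : ∀ d → ModulusFor d (dbar d)
dbar-modulus d with dbar d | dbar-spec d
... | _ | inj₁ refl = (+ 2 ⊛ ∣-refl) , (+ d ⊛ ∣-refl)
... | _ | inj₂ (refl , ℕ∣.divides q d≡q*2) =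
  divides (+ 1) (sym (trans (ℤₚ.*-identityˡ (+ (2 ℕ.* d))) (ℤₚ.pos-* 2 d))) ,
  divides (+ q) (trans (sym (ℤₚ.pos-* d d)) (trans (cong +_ d*d≡q*2d) (ℤₚ.pos-* q (2 ℕ.* d))))
  where
  d*d≡q*2d : d ℕ.* d ≡ q ℕ.* (2 ℕ.* d)
  d*d≡q*2d = trans (cong (ℕ._* d) d≡q*2) (ℕₚ.*-assoc q 2 d)

d∣dbar : ∀ d → d ℕ∣.∣ dbar d
d∣dbar d with dbar d | dbar-spec d
... | _ | inj₁ refl       = ℕ∣.∣-refl
... | _ | inj₂ (refl , _) = ℕ∣.n∣m*n 2

dbar-nonZero : ∀ d → d ≥ 4 → NonZero (dbar d)
dbar-nonZero (suc d) _ with dbar (suc d) | dbar-spec (suc d)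
... | _ | inj₁ refl       = _
... | _ | inj₂ (refl , _) = _

3∣dbar⇒3∣d : ∀ d → 3 ℕ∣.∣ dbar d → 3 ℕ∣.∣ d
3∣dbar⇒3∣d d h = +∣+⁻¹ ([ id , id ]′ (prime-∣* (+ d) (+ d) prime[3] (∣-trans (+∣+ h) (proj₂ (dbar-modulus d)))))

9∣dbar⇒9∣d : ∀ d → 9 ℕ∣.∣ dbar d → 9 ℕ∣.∣ d
9∣dbar⇒9∣d d h = coprime-divisor (toWitness {a? = coprime? 9 2} _)
  (+∣+⁻¹ (subst (+ 9 ∣_) (sym (ℤₚ.pos-* 2 d)) (∣-trans (+∣+ h) (proj₁ (dbar-modulus d)))))

3∣d⇒d%9 : ∀ d → 3 ℕ∣.∣ d → d % 9 ≡ 0 ⊎ d % 9 ≡ 3 ⊎ d % 9 ≡ 6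
3∣d⇒d%9 d 3∣d = cases (ℕ∣.%-presˡ-∣ {n = 9} 3∣d (ℕ∣.divides 3 refl)) (ℕDM.m%n<n d 9)
  where
  cases : ∀ {r} → 3 ℕ∣.∣ r → r < 9 → r ≡ 0 ⊎ r ≡ 3 ⊎ r ≡ 6
  cases (ℕ∣.divides 0 eq) _ = inj₁ eq
  cases (ℕ∣.divides 1 eq) _ = inj₂ (inj₁ eq)
  cases (ℕ∣.divides 2 eq) _ = inj₂ (inj₂ eq)
  cases (ℕ∣.divides (suc (suc (suc q))) refl) (s≤s (s≤s (s≤s (s≤s (s≤s (s≤s (s≤s (s≤s (s≤s ())))))))))

-- tr² − 4 det = (e − a)² + 4bc would be divisible by 9, but (d − 1)² − 4 = −3 (mod 9).
9∣⇒¬scalar₃ : ∀ d n M → 9 ℕ∣.∣ d → 9 ℕ∣.∣ n → DetTr′ d n M → ¬ Scalar 3 M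
9∣⇒¬scalar₃ d n (mat a b c e) 9∣d 9∣n (n∣det , n∣tr) (3∣b , 3∣c , 3∣e-a) =
  ℕ∣.>⇒∤ (s≤s (s≤s (s≤s (s≤s ℕ.z≤n)))) (+∣+⁻¹ 9∣3)
  where
  9∣* : ∀ {x y} → + 3 ∣ x → + 3 ∣ y → + 9 ∣ x * y
  9∣* {x} {y} (divides q refl) (divides r refl) = divides (q * r) (eq q r)
    where
    eq : ∀ q r → (q * + 3) * (r * + 3) ≡ q * r * + 9
    eq = solve-∀
  eq : ∀ a b c e d → + 3 ≡ (d - + 2) * d + (a + e + (d - + 1)) * ((a + e) - (d - + 1))
    + - + 4 * ((a * e - b * c) - + 1) + - + 1 * ((e - a) * (e - a)) + - + 4 * (b * c)
  eq = solve-∀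
  9∣3 : + 9 ∣ + 3
  9∣3 = by-≡ (eq a b c e (+ d))
    (((+ d - + 2) ⊛ +∣+ 9∣d) ⊕ ((a + e + (+ d - + 1)) ⊛ ∣-trans (+∣+ 9∣n) n∣tr)
     ⊕ (- + 4 ⊛ ∣-trans (+∣+ 9∣n) n∣det) ⊕ (- + 1 ⊛ 9∣* 3∣e-a 3∣e-a) ⊕ (- + 4 ⊛ 9∣* 3∣b 3∣c))

DetTr⇒DetTr′ : ∀ d M → DetTr d M → DetTr′ d (dbar d) M
DetTr⇒DetTr′ d M (_ , h , k) = mod⇒∣ (dbar d) (det M) (+ 1) h , mod⇒∣ (dbar d) (tr M) (+ d - + 1) k

DetTr′⇒DetTr : ∀ d M → InESL (dbar d) M → DetTr′ d (dbar d) M → DetTr d M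
DetTr′⇒DetTr d M M∈ESL (h , k) =
  M∈ESL , ∣⇒mod (dbar d) (det M) (+ 1) h , ∣⇒mod (dbar d) (tr M) (+ d - + 1) k

Conj-Fz⇒DetTr : ∀ d M → InESL (dbar d) M → Conj (dbar d) M (Fz d) → DetTr d M
Conj-Fz⇒DetTr d M M∈ESL conj = DetTr′⇒DetTr d M M∈ESL
  (Conj⇒DetTr′ d (dbar d) M (Fz d) (DetTr′-Fz d (dbar d) (dbar-modulus d)) conj)

-- The classification according to `d` modulo 9

one-class : ∀ d → d ≥ 4 → d % 9 ≢ 3 → d % 9 ≢ 6 → ∀ M → InESL (dbar d) M →
  DetTr d M ⇔ Conj (dbar d) M (Fz d)
one-class d d≥4 ≢3 ≢6 M M∈ESL = mk⇔ to (Conj-Fz⇒DetTr d M M∈ESL)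
  where
  -- A multiple of 3 is 0, 3 or 6 modulo 9, and the last two are excluded.
  9∣d : 3 ℕ∣.∣ d → 9 ℕ∣.∣ d
  9∣d 3∣d = [ ℕ∣.m%n≡0⇒n∣m d 9 , [ (λ ≡3 → contradiction ≡3 ≢3) , (λ ≡6 → contradiction ≡6 ≢6) ]′ ]′ (3∣d⇒d%9 d 3∣d)
  to : DetTr d M → Conj (dbar d) M (Fz d)
  to dt = ¬scalar₃⇒Conj-Fz d (dbar d) {{dbar-nonZero d d≥4}} M (dbar-modulus d) dt′ λ 3∣n →
    let 9∣ = 9∣d (3∣dbar⇒3∣d d 3∣n) in 9∣⇒¬scalar₃ d (dbar d) M 9∣ (ℕ∣.∣-trans 9∣ (d∣dbar d)) dt′
    where dt′ = DetTr⇒DetTr′ d M dt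

-- Modulo 3 a conjugating matrix would satisfy `P = Fz d · P`. The first row of `P` would then be
-- `d − 1` times the second, so `det P = 0`, which is not ±1 modulo 3.
¬Conj-scalar₃-Fz : ∀ d n F → 3 ℕ∣.∣ n → F ≅[ 3 ] I₂ → ¬ Conj n F (Fz d)
¬Conj-scalar₃-Fz d n F 3∣n F≅I (P@(mat p q r s) , P∈ESL , P-comm) = absurd (InESL⇒sign n P P∈ESL)
  where
  reduce : ∀ A B → A ≅[ n ] B → A ≅[ 3 ] B
  reduce A B (h₁ , h₂ , h₃ , h₄) =
    ∣-trans (+∣+ 3∣n) h₁ , ∣-trans (+∣+ 3∣n) h₂ , ∣-trans (+∣+ 3∣n) h₃ , ∣-trans (+∣+ 3∣n) h₄
  P≅FzP : P ≅[ 3 ] (Fz d · P)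
  P≅FzP = ≅-trans 3 P (P · I₂) (Fz d · P) (≅-reflexive 3 (sym (·-identityʳ P)))
    (≅-trans 3 (P · I₂) (P · F) (Fz d · P) (·-congˡ 3 P I₂ F (≅-sym 3 F I₂ F≅I))
      (reduce (P · F) (Fz d · P) (≈⇒≅ n (P · F) (Fz d · P) P-comm)))
  eq : ∀ p q r s d → (p * s - q * r) * + 1
    ≡ s * (p - (+ 0 * p + (d - + 1) * r)) + - r * (q - (+ 0 * q + (d - + 1) * s))
  eq = solve-∀
  3∣det : + 3 ∣ det P * + 1
  3∣det = by-≡ (eq p q r s (+ d)) ((s ⊛ proj₁ P≅FzP) ⊕ (- r ⊛ proj₁ (proj₂ P≅FzP)))
  absurd : ¬ (∃[ s ] IsSign s × + n ∣ det P - s)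
  absurd (s , sgn , h) = ℕ∣.>⇒∤ (s≤s (s≤s ℕ.z≤n))
    (+∣+⁻¹ (sign-unit-cancel s (det P) (+ 1) sgn (∣-trans (+∣+ 3∣n) h) 3∣det))

two-classes : ∀ d → d ≥ 4 → 3 ℕ∣.∣ d → ¬ 9 ℕ∣.∣ d → ∀ F → DetTr′ d (dbar d) F → Scalar 3 F →
  ((M : Mat) → InESL (dbar d) M → DetTr d M ⇔ (Conj (dbar d) M (Fz d) ⊎ Conj (dbar d) M F))
  × ¬ Conj (dbar d) F (Fz d)
two-classes d d≥4 3∣d 9∤d F dtF scF =
  (λ M M∈ESL → mk⇔ (λ dt → to M (DetTr⇒DetTr′ d M dt) (scalar? 3 M))
    [ Conj-Fz⇒DetTr d M M∈ESL , (λ conj → DetTr′⇒DetTr d M M∈ESL (Conj⇒DetTr′ d (dbar d) M F dtF conj)) ]′)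
  , ¬Conj-scalar₃-Fz d (dbar d) F 3∣n (scalar₃⇒≅I d (dbar d) F 3∣n 3∣d dtF scF)
  where
  3∣n : 3 ℕ∣.∣ dbar d
  3∣n = ℕ∣.∣-trans 3∣d (d∣dbar d)

  -- The modulus is abstracted to a variable so that it can be replaced by `3m`; then `9 ∤ n` gives
  -- `3 ∤ m`, as gluing at 3 requires.
  scalar-case : ∀ n → NonZero n → (∃[ m ] n ≡ 3 ℕ.* m) → ¬ 9 ℕ∣.∣ n → ModulusFor d n → ∀ M →
    DetTr′ d n M → DetTr′ d n F → Scalar 3 M → Conj n M F
  scalar-case n nz (m , refl) 9∤n md M dtM dtF scM =
    scalar₃⇒Conj d m {{ℕₚ.m*n≢0⇒n≢0 3 {{nz}}}} M F (9∤n ∘ ℕ∣.*-monoʳ-∣ 3) 3∣d md dtM dtF scM scF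

  to : ∀ M → DetTr′ d (dbar d) M → Dec (Scalar 3 M) → Conj (dbar d) M (Fz d) ⊎ Conj (dbar d) M F
  to M dt (yes sc) = inj₂ (scalar-case (dbar d) (dbar-nonZero d d≥4)
    (ℕ∣.quotient 3∣n , ℕ∣.m∣n⇒n≡m*quotient 3∣n) (9∤d ∘ 9∣dbar⇒9∣d d) (dbar-modulus d) M dt dtF sc)
  to M dt (no ¬sc) = inj₁ (¬scalar₃⇒Conj-Fz d (dbar d) {{dbar-nonZero d d≥4}} M (dbar-modulus d) dt (λ _ → ¬sc))

-- The representatives `Fa` and `Fa'`

exact-quotient : ∀ {k} x → k ≡ 3 ℕ.+ x ℕ.* 3 → (k ℕ.∸ 3) ℕ./ 3 ≡ x
exact-quotient x refl = trans (cong (ℕ._/ 3) (ℕₚ.m+n∸m≡n 3 (x ℕ.* 3))) (ℕDM.m*n/n≡m x 3)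

d≡r+9q : ∀ d {r} → d % 9 ≡ r → d ≡ r ℕ.+ d ℕ./ 9 ℕ.* 9
d≡r+9q d refl = ℕDM.m≡m%n+[m/n]*n d 9

pos-r+qk : ∀ r q k → + (r ℕ.+ q ℕ.* k) ≡ + r + + q * + k
pos-r+qk r q k = cong (_+_ (+ r)) (ℤₚ.pos-* q k)

3∣d%9⇒3∣d : ∀ d → 3 ℕ∣.∣ d % 9 → 3 ℕ∣.∣ d
3∣d%9⇒3∣d d = ℕ∣.∣n∣m%n⇒∣m {n = 9} (ℕ∣.divides 3 refl)

d%9≢0⇒9∤d : ∀ d {r} → d % 9 ≡ suc r → ¬ 9 ℕ∣.∣ d
d%9≢0⇒9∤d d eq 9∣d = ℕₚ.0≢1+n (trans (sym (ℕ∣.n∣m⇒m%n≡0 d 9 9∣d)) eq)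

-- The matrices `Fa d` and `Fa' d` differ only in the lower left entry `z`, so trace and scalarity
-- modulo 3 are checked for both at once.
two-classes-Fa : ∀ d → d ≥ 4 → ∀ z → 3 ℕ∣.∣ d → ¬ 9 ℕ∣.∣ d → + 3 ∣ z →
  + dbar d ∣ + 1 * (+ d - + 2) - (+ d + + 3) * z - + 1 →
  let F = mat (+ 1) (+ d + + 3) z (+ d - + 2) in
  ((M : Mat) → InESL (dbar d) M → DetTr d M ⇔ (Conj (dbar d) M (Fz d) ⊎ Conj (dbar d) M F))
  × ¬ Conj (dbar d) F (Fz d)
two-classes-Fa d d≥4 z 3∣d 9∤d 3∣z F-det =
  two-classes d d≥4 3∣d 9∤d (mat (+ 1) (+ d + + 3) z (+ d - + 2))
    (F-det , ≡⇒∣diff (tr-eq (+ d)))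
    (+∣+ 3∣d ⊕ ∣-refl , 3∣z , by-≡ (e-a-eq (+ d)) (+∣+ 3∣d ⊕ (- + 1 ⊛ ∣-refl)))
  where
  tr-eq : ∀ d → + 1 + (d - + 2) ≡ d - + 1
  tr-eq = solve-∀
  e-a-eq : ∀ d → (d - + 2) - + 1 ≡ d + - + 1 * + 3
  e-a-eq = solve-∀

Fa-quotient : ∀ d → d % 9 ≡ 3 → (4 ℕ.* d ℕ.∸ 3) ℕ./ 3 ≡ 3 ℕ.+ d ℕ./ 9 ℕ.* 12
Fa-quotient d ≡3 = exact-quotient (3 ℕ.+ d ℕ./ 9 ℕ.* 12) (trans (cong (4 ℕ.*_) (d≡r+9q d ≡3)) (eq (d ℕ./ 9)))
  where
  eq : ∀ q → 4 ℕ.* (3 ℕ.+ q ℕ.* 9) ≡ 3 ℕ.+ (3 ℕ.+ q ℕ.* 12) ℕ.* 3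
  eq = ℕ-Solver.solve-∀

Fa'-quotient : ∀ d → d % 9 ≡ 6 → (2 ℕ.* d ℕ.∸ 3) ℕ./ 3 ≡ 3 ℕ.+ d ℕ./ 9 ℕ.* 6
Fa'-quotient d ≡6 = exact-quotient (3 ℕ.+ d ℕ./ 9 ℕ.* 6) (trans (cong (2 ℕ.*_) (d≡r+9q d ≡6)) (eq (d ℕ./ 9)))
  where
  eq : ∀ q → 2 ℕ.* (6 ℕ.+ q ℕ.* 9) ≡ 3 ℕ.+ (3 ℕ.+ q ℕ.* 6) ℕ.* 3
  eq = ℕ-Solver.solve-∀

det-Fa : ∀ d → d % 9 ≡ 3 → + dbar d ∣ det (Fa d) - + 1
det-Fa d ≡3 = by-≡ (cong₂ (λ x z → + 1 * (x - + 2) - (x + + 3) * z - + 1) d≡ c≡)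
  (by-≡ (eq (+ (d ℕ./ 9)))
    -- With `d = 3 + 9q`, `det (Fa d) − 1 = −(3 + 6q) · 2d`, and `dbar d ∣ 2d`.
    (- (+ 3 + + 6 * + (d ℕ./ 9)) ⊛ subst (λ x → + dbar d ∣ + 2 * x) d≡ (proj₁ (dbar-modulus d))))
  where
  d≡ : + d ≡ + 3 + + (d ℕ./ 9) * + 9
  d≡ = trans (cong +_ (d≡r+9q d ≡3)) (pos-r+qk 3 (d ℕ./ 9) 9)
  c≡ : c (Fa d) ≡ + 3 + + (d ℕ./ 9) * + 12
  c≡ = trans (cong +_ (Fa-quotient d ≡3)) (pos-r+qk 3 (d ℕ./ 9) 12)
  eq : ∀ q → + 1 * ((+ 3 + q * + 9) - + 2) - ((+ 3 + q * + 9) + + 3) * (+ 3 + q * + 12) - + 1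
    ≡ - (+ 3 + + 6 * q) * (+ 2 * (+ 3 + q * + 9))
  eq = solve-∀

det-Fa' : ∀ d → d % 9 ≡ 6 → + dbar d ∣ det (Fa' d) - + 1
det-Fa' d ≡6 = by-≡ (cong₂ (λ x z → + 1 * (x - + 2) - (x + + 3) * z - + 1) d≡ c≡)
  (by-≡ (eq (+ (d ℕ./ 9)))
    -- With `d = 6 + 9q`, `det (Fa' d) − 1 = −(2 + 3q) · 2d`, where `2 + 3q = d/3`.
    (- (+ 2 + + 3 * + (d ℕ./ 9)) ⊛ subst (λ x → + dbar d ∣ + 2 * x) d≡ (proj₁ (dbar-modulus d))))
  where
  d≡ : + d ≡ + 6 + + (d ℕ./ 9) * + 9
  d≡ = trans (cong +_ (d≡r+9q d ≡6)) (pos-r+qk 6 (d ℕ./ 9) 9)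
  c≡ : c (Fa' d) ≡ + 3 + + (d ℕ./ 9) * + 6
  c≡ = trans (cong +_ (Fa'-quotient d ≡6)) (pos-r+qk 3 (d ℕ./ 9) 6)
  eq : ∀ q → + 1 * ((+ 6 + q * + 9) - + 2) - ((+ 6 + q * + 9) + + 3) * (+ 3 + q * + 6) - + 1
    ≡ - (+ 2 + + 3 * q) * (+ 2 * (+ 6 + q * + 9))
  eq = solve-∀

theorem3p12 : (d : ℕ) → d ≥ 4 →
    ((d % 9 ≢ 3) → (d % 9 ≢ 6) →
    (M : Mat) → InESL (dbar d) M → (DetTr d M ⇔ Conj (dbar d) M (Fz d)))
    × ((d % 9 ≡ 3) →
    ((M : Mat) → InESL (dbar d) M →
    (DetTr d M ⇔ (Conj (dbar d) M (Fz d) ⊎ Conj (dbar d) M (Fa d))))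
    × ¬ Conj (dbar d) (Fa d) (Fz d))
    × ((d % 9 ≡ 6) →
    ((M : Mat) → InESL (dbar d) M →
    (DetTr d M ⇔ (Conj (dbar d) M (Fz d) ⊎ Conj (dbar d) M (Fa' d))))
    × ¬ Conj (dbar d) (Fa' d) (Fz d))
theorem3p12 d d≥4 = one-class d d≥4
  , (λ ≡3 → two-classes-Fa d d≥4 (c (Fa d))
      (3∣d%9⇒3∣d d (ℕ∣.divides 1 ≡3)) (d%9≢0⇒9∤d d ≡3)
      (+∣+ (ℕ∣.divides (1 ℕ.+ d ℕ./ 9 ℕ.* 4) (trans (Fa-quotient d ≡3) (eq (d ℕ./ 9)))))
      (det-Fa d ≡3))
  , (λ ≡6 → two-classes-Fa d d≥4 (c (Fa' d))
      (3∣d%9⇒3∣d d (ℕ∣.divides 2 ≡6)) (d%9≢0⇒9∤d d ≡6)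
      (+∣+ (ℕ∣.divides (1 ℕ.+ d ℕ./ 9 ℕ.* 2) (trans (Fa'-quotient d ≡6) (eq′ (d ℕ./ 9)))))
      (det-Fa' d ≡6))
  where
  eq : ∀ q → 3 ℕ.+ q ℕ.* 12 ≡ (1 ℕ.+ q ℕ.* 4) ℕ.* 3
  eq = ℕ-Solver.solve-∀
  eq′ : ∀ q → 3 ℕ.+ q ℕ.* 6 ≡ (1 ℕ.+ q ℕ.* 2) ℕ.* 3
  eq′ = ℕ-Solver.solve-∀
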